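{- Let $(\Sigma,\mathrm{ar})$ be a non-trivial mixed binding signature. Then the canonical injection $T_\Sigma^\infty/{\approx_\alpha}\hookrightarrow (T_\Sigma/{\approx_\alpha})^\infty$ is an isomorphism (bijection) if and only if the set of variables $\mathcal{V}$ is uncountable.
   Context: Fix a set $\mathcal{V}$ of variables; permutations of $\mathcal{V}$ generated by transpositions act on terms. A mixed binding signature (MBS) is a pair $(\Sigma,\mathrm{ar})$ with $\Sigma$ an at most countable set of constructors and $\mathrm{ar}:\Sigma\to(\mathbb{N}\times\{0,1\})^*$; for $\mathrm{ar}(c)=((n_1,b_1),\dots,(n_k,b_k))$ argument $i$ binds $n_i$ variables and is inductive ($b_i=0$) or coinductive ($b_i=1$). Raw finite terms $T_\Sigma$: finite trees built from variables $x\in\mathcal{V}$ and nodes $c(\bar x_1.t_1,\dots,\bar x_k.t_k)$ with $\bar x_i\in\mathcal{V}^{n_i}$ (i.e. $\mu Z.T_\Sigma(Z,Z)$ for the term functor $T_\Sigma(X,Y)=\mathcal{V}+\coprod_c\prod_i\mathcal{V}^{n_i}\times\pi_{b_i}(X,Y)$, $\pi_0(X,Y)=X,\pi_1(X,Y)=Y$). Raw mixed terms $T_\Sigma^\infty=\nu Y.\mu X.T_\Sigma(X,Y)$ in $\mathbf{Set}$: possibly infinite such trees in which every infinite branch passes through infinitely many coinductive argument positions. Permutation action: $\sigma\cdot x=\sigma(x)$, $\sigma\cdot c(\bar x_1.t_1,\dots)=c(\sigma(\bar x_1).\sigma\cdot t_1,\dots)$. $\alpha$-equivalence on finite terms (including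 finite terms using an extra constant $*$, with $*\approx_\alpha *$): $x\approx_\alpha x$, and $c(\bar x_1.t_1,\dots,\bar x_k.t_k)\approx_\alpha c(\bar y_1.u_1,\dots,\bar y_k.u_k)$ whenever for each $i$, $(\bar x_i\,\bar z_i)\cdot t_i\approx_\alpha(\bar y_i\,\bar z_i)\cdot u_i$ for fresh $\bar z_i$. Truncation: $[t]_0=*$, $[x]_{n+1}=x$, $[c(\bar x_1.t_1,\dots,\bar x_k.t_k)]_{n+1}=c(\bar x_1.[t_1]_{n+1-b_1},\dots,\bar x_k.[t_k]_{n+1-b_k})$. Mixed terms $t,u$ are $\alpha$-equivalent iff $[t]_n\approx_\alpha[u]_n$ for all $n$; $T_\Sigma^\infty/{\approx_\alpha}$ is the quotient. On $T_\Sigma/{\approx_\alpha}$ define the metric $d_\alpha(t,u)=\inf\{2^{ -n}:[t]_n\approx_\alpha[u]_n\}$, and let $(T_\Sigma/{\approx_\alpha})^\infty$ be its Cauchy completion. The canonical injection sends the class of a mixed term $t$ to the limit of the classes of finite terms converging to $t$ in the Arnold–Nivat metric $d(t,u)=\inf\{2^{ -n}:[t]_n=[u]_n\}$. The MBS is non-trivial if there are constructors $\ell,n,g\in\Sigma$ with: $\ell$ having a binding argument ($n_i\geq1$ for some $i$); $n$ having at least two arguments; $g$ having a coinductive argument ($b_i=1$ for some $i$). -}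

module Defs where

open import Data.Nat using (ℕ; zero; suc; _≤_)
open import Data.Bool using (Bool; true; false; if_then_else_)
open import Data.Product using (Σ; ∃; ∃-syntax; _×_; _,_; proj₁; proj₂)
open import Data.Sum using (_⊎_)
open import Data.List using (List; []; _∷_; length)
open import Data.List.Relation.Unary.Any using (Any)
open import Data.Vec using (Vec; []; _∷_)
open import Relation.Nullary using (¬_; yes; no)
open import Relation.Binary.Definitions using (DecidableEquality)
open import Relation.Binary.PropositionalEquality using (_≡_; _≢_)

AtMostCountable : Set → Set
AtMostCountable A = (¬ A) ⊎ (Σ (ℕ → A) λ f → ∀ (a : A) → ∃[ n ] f n ≡ a)

Uncountable : Set → Set
Uncountable A = ¬ AtMostCountable A

Infinite : Set → Set
Infinite A = Σ (ℕ → A) λ f → ∀ m n → f m ≡ f n → m ≡ n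

-- An arity: list of (number of bound variables, coinductive?) ; false = inductive (b=0),
-- true = coinductive (b=1).
Arity : Set
Arity = List (ℕ × Bool)

NonTrivial : (Con : Set) → (Con → Arity) → Set
NonTrivial Con ar =
    (∃[ l ] Any (λ p → 1 ≤ proj₁ p) (ar l))
  × (∃[ n ] 2 ≤ length (ar n))
  × (∃[ g ] Any (λ p → proj₂ p ≡ true) (ar g))

module _ (V : Set) (_≟_ : DecidableEquality V) (Con : Set) (ar : Con → Arity) where

  -- Raw finite terms, possibly containing the extra constant *  (star).
  -- Raw finite terms T_Σ are those satisfying StarFree.

  data FT : Set
  data FArgs : Arity → Set

  data FT where
    var  : V → FT
    star : FT
    node : (c : Con) → FArgs (ar c) → FT

  data FArgs where
    []  : FArgs []
    arg : ∀ {n b as} → Vec V n → FT → FArgs as → FArgs ((n , b) ∷ as)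

  data StarFree : FT → Set
  data StarFreeA : ∀ {as} → FArgs as → Set

  data StarFree where
    var  : ∀ {x} → StarFree (var x)
    node : ∀ {c as} → StarFreeA as → StarFree (node c as)

  data StarFreeA where
    []  : StarFreeA []
    arg : ∀ {n b as} {xs : Vec V n} {t : FT} {r : FArgs as} →
          StarFree t → StarFreeA r → StarFreeA (arg {b = b} xs t r)

  data _∈V_ : ∀ {n} → V → Vec V n → Set where
    here  : ∀ {n x} {xs : Vec V n} → x ∈V (x ∷ xs)
    there : ∀ {n x y} {xs : Vec V n} → x ∈V xs → x ∈V (y ∷ xs)

  data _occursIn_ (z : V) : FT → Set
  data _occursInA_ (z : V) : ∀ {as} → FArgs as → Set

  data _occursIn_ z where
    var  : z occursIn var z
    node : ∀ {c as} → z occursInA as → z occursIn node c as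

  data _occursInA_ z where
    binder : ∀ {n b as} {xs : Vec V n} {t : FT} {r : FArgs as} →
             z ∈V xs → z occursInA (arg {b = b} xs t r)
    body   : ∀ {n b as} {xs : Vec V n} {t : FT} {r : FArgs as} →
             z occursIn t → z occursInA (arg {b = b} xs t r)
    rest   : ∀ {n b as} {xs : Vec V n} {t : FT} {r : FArgs as} →
             z occursInA r → z occursInA (arg {b = b} xs t r)

  swapV : V → V → V → V
  swapV x y z with z ≟ x
  ... | yes _ = y
  ... | no _ with z ≟ y
  ...   | yes _ = x
  ...   | no _ = z

  swapVec : ∀ {n} → V → V → Vec V n → Vec V n
  swapVec x y []       = []
  swapVec x y (z ∷ zs) = swapV x y z ∷ swapVec x y zs

  swapT : V → V → FT → FT
  swapA : ∀ {as} → V → V → FArgs as → FArgs as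
  swapT x y (var z)     = var (swapV x y z)
  swapT x y star        = star
  swapT x y (node c as) = node c (swapA x y as)
  swapA x y []            = []
  swapA x y (arg xs t r)  = arg (swapVec x y xs) (swapT x y t) (swapA x y r)

  perm : ∀ {n} → Vec V n → Vec V n → FT → FT
  perm []       []       t = t
  perm (x ∷ xs) (z ∷ zs) t = swapT x z (perm xs zs t)

  Distinct : ∀ {n} → Vec V n → Set
  Distinct []       = Data.Unit.⊤ where import Data.Unit
  Distinct (z ∷ zs) = ¬ (z ∈V zs) × Distinct zs

  Fresh : ∀ {n} → Vec V n → Vec V n → Vec V n → FT → FT → Set
  Fresh zs xs ys t u =
    Distinct zs ×
    (∀ z → z ∈V zs → ¬ (z ∈V xs) × ¬ (z ∈V ys) × ¬ (z occursIn t) × ¬ (z occursIn u))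

  data _≈α_ : FT → FT → Set
  data _≈αA_ : ∀ {as} → FArgs as → FArgs as → Set

  data _≈α_ where
    var  : ∀ {x} → var x ≈α var x
    star : star ≈α star
    node : ∀ {c} {as bs : FArgs (ar c)} → as ≈αA bs → node c as ≈α node c bs

  data _≈αA_ where
    []  : [] ≈αA []
    arg : ∀ {n b as} {xs ys : Vec V n} {t u : FT} {r r' : FArgs as} →
          (Σ (Vec V n) λ zs → Fresh zs xs ys t u × (perm xs zs t ≈α perm ys zs u)) →
          r ≈αA r' →
          arg {b = b} xs t r ≈αA arg {b = b} ys u r'

  ftrunc  : ℕ → FT → FT
  ftruncA : ∀ {as} → ℕ → FArgs as → FArgs as   -- ftruncA n : budget (suc n)
  ftrunc zero    _           = star
  ftrunc (suc n) (var x)     = var x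
  ftrunc (suc n) star        = star
  ftrunc (suc n) (node c as) = node c (ftruncA n as)
  ftruncA n []                       = []
  ftruncA n (arg {b = false} xs t r) = arg xs (ftrunc (suc n) t) (ftruncA n r)
  ftruncA n (arg {b = true}  xs t r) = arg xs (ftrunc n t)       (ftruncA n r)

  -- Raw mixed terms  T^∞ = νY. μX. T_Σ(X,Y)  in Set.
  -- G^n(1) is the set of finite terms with * in which * occurs exactly at the
  -- cut positions after n coinductive argument positions (Level n), and the
  -- connecting maps are the truncations.  An element of the limit is thus a
  -- family (a_n) with a_n = [a_{n+1}]_n, and a_n is the truncation [t]_n of
  -- the mixed term t it represents.

  data Level : ℕ → FT → Set
  data LevelA : ℕ → ∀ {as} → FArgs as → Set      -- LevelA n : budget (suc n)

  data Level where
    cut  : Level zero star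
    var  : ∀ {n x} → Level (suc n) (var x)
    node : ∀ {n c as} → LevelA n as → Level (suc n) (node c as)

  data LevelA where
    []  : ∀ {n} → LevelA n []
    ind : ∀ {n m as} {xs : Vec V m} {t : FT} {r : FArgs as} →
          Level (suc n) t → LevelA n r → LevelA n (arg {b = false} xs t r)
    coi : ∀ {n m as} {xs : Vec V m} {t : FT} {r : FArgs as} →
          Level n t → LevelA n r → LevelA n (arg {b = true} xs t r)

  record Mixed : Set where
    field
      approx   : ℕ → FT
      level    : ∀ n → Level n (approx n)
      coherent : ∀ n → ftrunc n (approx (suc n)) ≡ approx n

  open Mixed public

  trunc : ℕ → Mixed → FT
  trunc n t = approx t n

  _≈α∞_ : Mixed → Mixed → Set
  t ≈α∞ u = ∀ n → trunc n t ≈α trunc n u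

  -- Cauchy completion of (T_Σ/≈α , d_α), presented by sequences of raw
  -- finite terms.  d_α(t,u) ≤ 2^{-n}  iff  [t]_n ≈α [u]_n.

  FiniteSeq : (ℕ → FT) → Set
  FiniteSeq s = ∀ k → StarFree (s k)

  Cauchy : (ℕ → FT) → Set
  Cauchy s = ∀ n → ∃[ N ] (∀ i j → N ≤ i → N ≤ j → ftrunc n (s i) ≈α ftrunc n (s j))

  -- equality in the completion: d_α(s_k, s'_k) → 0
  _∼_ : (ℕ → FT) → (ℕ → FT) → Set
  s ∼ s' = ∀ n → ∃[ N ] (∀ k → N ≤ k → ftrunc n (s k) ≈α ftrunc n (s' k))

  -- s converges to the mixed term t in the Arnold–Nivat metric
  -- (d(s_k,t) ≤ 2^{-n} iff [s_k]_n = [t]_n)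
  ConvergesAN : (ℕ → FT) → Mixed → Set
  ConvergesAN s t = ∀ n → ∃[ N ] (∀ k → N ≤ k → ftrunc n (s k) ≡ trunc n t)

  -- graph of the canonical injection: the class of t is sent to the
  -- limit of the classes of any sequence of finite terms converging to t
  Represents : Mixed → (ℕ → FT) → Set
  Represents t s = FiniteSeq s × ConvergesAN s t

  CanonicalInjectionBijective : Set
  CanonicalInjectionBijective =
      (∀ t → ∃[ s ] Represents t s)
    × (∀ t u s s' → t ≈α∞ u → Represents t s → Represents u s' → s ∼ s')
    × (∀ t u s s' → Represents t s → Represents u s' → s ∼ s' → t ≈α∞ u)
    × (∀ s → FiniteSeq s → Cauchy s →
         ∃[ t ] ∃[ s' ] (Represents t s' × s' ∼ s))

-- Replacing bound variables by names for their depth (de Bruijn levels) gives normal forms which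
-- decide α-equivalence and commute with truncation.  If V is uncountable, only countably many
-- variables occur in the truncations of a Cauchy sequence, so the names can be taken among the
-- remaining variables; the normal forms of the truncations then cohere to a raw mixed term.  If
-- V = {x₀, x₁, …}, the terms sₖ = ℓ(zₖ. N(x₀, G(N(x₁, G(…))))) cut off at depth k, with zₖ fresh,
-- form a Cauchy sequence, but a limit would bind some x_m at ℓ although x_m is free below it.
module Submission where

open import Defs
open import Level using (0ℓ)
open import Data.Nat using (ℕ; zero; suc; _+_; _≤_; _<_; _≤′_; _⊔_; z≤n; s≤s; ≤′-refl; ≤′-step)
import Data.Nat as ℕ
open import Data.Nat.Properties
  using (≤-refl; ≤-trans; n≤1+n; <⇒≢; <-cmp; m≤m⊔n; m≤n⊔m;
         ≤⇒≤′; ≤′⇒≤; m≤n⇒m<n∨m≡n; +-identityʳ; +-suc)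
open import Data.Bool using (Bool; true; false)
open import Data.Product using (Σ; ∃-syntax; _×_; _,_; proj₁; proj₂)
open import Data.Sum using (_⊎_; inj₁; inj₂)
open import Data.Sum.Properties using (inj₁-injective; inj₂-injective; ≡-dec)
open import Data.Empty using (⊥; ⊥-elim)
open import Data.Unit using (tt)
open import Data.List using (List; []; _∷_; _++_; length; lookup)
open import Data.List.Membership.Propositional using (_∈_)
open import Data.List.Membership.Propositional.Properties using (∈-++⁺ˡ; ∈-++⁺ʳ)
open import Data.List.Relation.Unary.Any using (Any; here; there; index)
open import Data.List.Relation.Unary.Any.Properties using (lookup-index)
open import Data.Vec using (Vec; []; _∷_; toList; replicate)
open import Data.Fin using (Fin; zero; suc)
import Data.Fin as Fin
open import Data.Fin.Properties using (toℕ-fromℕ<)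
open import Function using (_∘_; id)
open import Function.Bundles using (_⇔_; mk⇔)
open import Relation.Nullary using (¬_; yes; no)
open import Relation.Binary.Definitions using (DecidableEquality; tri<; tri≈; tri>)
open import Relation.Binary.PropositionalEquality
  using (_≡_; _≢_; refl; sym; trans; cong; cong₂; subst; subst₂; module ≡-Reasoning)
open import Axiom.ExcludedMiddle using (ExcludedMiddle)

-- Canonical forms are taken in two alphabets. In `V ⊎ ℕ` a name never clashes with a free variable,
-- so every term has a normal form there and equality of normal forms is α-equivalence. A mixed
-- term, however, must be written in `V` itself, so a limit needs names from an injective sequence
-- `F : ℕ → V`. Such a renaming identifies α-equivalent terms, but it may capture free variables; it
-- stays in the α-class when the names avoid the variables that occur. `canon-canon` makes this
-- precise, and uncountability serves to supply such an `F`. The contradiction rests on mixed terms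
-- being raw: coherence fixes the binders at `ℓ` at precision 1, so `x m` can be read off first and
-- the precision chosen afterwards, deep enough to see `x m` in the body.

module Syntax {V : Set} (_≟_ : DecidableEquality V) (Con : Set) (ar : Con → Arity) where
  Term = FT V _≟_ Con ar
  Args = FArgs V _≟_ Con ar
  infix 4 _∈ᵛ_ _occurs_ _occursᴬ_ _≈_ _≈ᴬ_
  _∈ᵛ_ : ∀ {n} → V → Vec V n → Set
  _∈ᵛ_ = _∈V_ V _≟_ Con ar
  _occurs_ = _occursIn_ V _≟_ Con ar
  _occursᴬ_ : ∀ {as} → V → Args as → Set
  z occursᴬ r = _occursInA_ V _≟_ Con ar z r
  swap = swapV V _≟_ Con ar
  swapᵛ : ∀ {n} → V → V → Vec V n → Vec V n
  swapᵛ = swapVec V _≟_ Con ar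
  swapᵗ = swapT V _≟_ Con ar
  swapᴬ : ∀ {as} → V → V → Args as → Args as
  swapᴬ = swapA V _≟_ Con ar
  permᵗ : ∀ {n} → Vec V n → Vec V n → Term → Term
  permᵗ = perm V _≟_ Con ar
  Distinctᵛ : ∀ {n} → Vec V n → Set
  Distinctᵛ = Distinct V _≟_ Con ar
  _≈_ = _≈α_ V _≟_ Con ar
  _≈ᴬ_ : ∀ {as} → Args as → Args as → Set
  _≈ᴬ_ = _≈αA_ V _≟_ Con ar
  chop = ftrunc V _≟_ Con ar
  chopᴬ : ∀ {as} → ℕ → Args as → Args as
  chopᴬ = ftruncA V _≟_ Con ar

  -- Occurring variables, iterated truncation, transpositions

  ∈ᵛ⇒∈ : ∀ {n v} {xs : Vec V n} → v ∈ᵛ xs → v ∈ toList xs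
  ∈ᵛ⇒∈ here      = here refl
  ∈ᵛ⇒∈ (there p) = there (∈ᵛ⇒∈ p)

  vars  : Term → List V
  varsᴬ : ∀ {as} → Args as → List V
  vars (var x)     = x ∷ []
  vars star        = []
  vars (node c as) = varsᴬ as
  varsᴬ []           = []
  varsᴬ (arg xs t r) = toList xs ++ vars t ++ varsᴬ r

  occurs⇒∈vars  : ∀ {z} {t : Term} → z occurs t → z ∈ vars t
  occurs⇒∈varsᴬ : ∀ {z as} {r : Args as} → z occursᴬ r → z ∈ varsᴬ r
  occurs⇒∈vars var      = here refl
  occurs⇒∈vars (node p) = occurs⇒∈varsᴬ p
  occurs⇒∈varsᴬ (binder p) = ∈-++⁺ˡ (∈ᵛ⇒∈ p)
  occurs⇒∈varsᴬ (body {xs = xs} p) = ∈-++⁺ʳ (toList xs) (∈-++⁺ˡ (occurs⇒∈vars p))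
  occurs⇒∈varsᴬ (rest {xs = xs} {t = t} p) =
    ∈-++⁺ʳ (toList xs) (∈-++⁺ʳ (vars t) (occurs⇒∈varsᴬ p))

  chop-chop  : ∀ {n k} t → n ≤ k → chop n (chop k t) ≡ chop n t
  chopᴬ-chopᴬ : ∀ {n k as} (r : Args as) → n ≤ k → chopᴬ n (chopᴬ k r) ≡ chopᴬ n r
  chop-chop t           z≤n     = refl
  chop-chop (var x)     (s≤s p) = refl
  chop-chop star        (s≤s p) = refl
  chop-chop (node c as) (s≤s p) = cong (node c) (chopᴬ-chopᴬ as p)
  chopᴬ-chopᴬ [] p = refl
  chopᴬ-chopᴬ (arg {b = false} xs t r) p = cong₂ (arg xs) (chop-chop t (s≤s p)) (chopᴬ-chopᴬ r p)
  chopᴬ-chopᴬ (arg {b = true}  xs t r) p = cong₂ (arg xs) (chop-chop t p) (chopᴬ-chopᴬ r p)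

  swap-self-inverse : ∀ x y v → swap x y (swap x y v) ≡ v
  swap-self-inverse x y v with v ≟ x
  swap-self-inverse x y v | yes refl with y ≟ v
  ... | yes y≡v = y≡v
  ... | no _ with y ≟ y
  ...   | yes _ = refl
  ...   | no y≢y = ⊥-elim (y≢y refl)
  swap-self-inverse x y v | no v≢x with v ≟ y
  swap-self-inverse x y v | no v≢x | yes refl with x ≟ x
  ... | yes _ = refl
  ... | no x≢x = ⊥-elim (x≢x refl)
  swap-self-inverse x y v | no v≢x | no v≢y with v ≟ x
  ... | yes v≡x = ⊥-elim (v≢x v≡x)
  ... | no _ with v ≟ y
  ...   | yes v≡y = ⊥-elim (v≢y v≡y)
  ...   | no _ = refl

  swap-injective : ∀ x y {u v} → swap x y u ≡ swap x y v → u ≡ v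
  swap-injective x y {u} {v} e =
    trans (sym (swap-self-inverse x y u)) (trans (cong (swap x y) e) (swap-self-inverse x y v))

  swap-fixes : ∀ {x y v} → v ≢ x → v ≢ y → swap x y v ≡ v
  swap-fixes {x} {y} {v} v≢x v≢y with v ≟ x
  ... | yes v≡x = ⊥-elim (v≢x v≡x)
  ... | no _ with v ≟ y
  ...   | yes v≡y = ⊥-elim (v≢y v≡y)
  ...   | no _ = refl

  permᵛ : ∀ {n} → Vec V n → Vec V n → V → V
  permᵛ []       []       v = v
  permᵛ (x ∷ xs) (z ∷ zs) v = swap x z (permᵛ xs zs v)

-- Addition in accumulating form: it recurses in step with `names` and `bind`, so levels match
-- definitionally in inductions over binder vectors.
shift : ℕ → ℕ → ℕ
shift zero    l = l
shift (suc m) l = shift m (suc l)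

-- Environments and their extension along binder vectors

module _ {V : Set} (_≟_ : DecidableEquality V) {W : Set} where

  update : (V → W) → V → W → V → W
  update ρ x w v with v ≟ x
  ... | yes _ = w
  ... | no _  = ρ v

  update-hit : ∀ ρ x w → update ρ x w x ≡ w
  update-hit ρ x w with x ≟ x
  ... | yes _ = refl
  ... | no x≢x = ⊥-elim (x≢x refl)

  update-miss : ∀ ρ {x v} w → v ≢ x → update ρ x w v ≡ ρ v
  update-miss ρ {x} {v} w v≢x with v ≟ x
  ... | yes v≡x = ⊥-elim (v≢x v≡x)
  ... | no _ = refl

  update-cong : ∀ {ρ ρ' x w v} → ρ v ≡ ρ' v → update ρ x w v ≡ update ρ' x w v
  update-cong {x = x} {v = v} e with v ≟ x
  ... | yes _ = refl
  ... | no _  = e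

  -- A repeated variable takes its rightmost value, in agreement with `permᵗ`, which applies the
  -- transposition of the last entry first.
  bind : ∀ {m} → (V → W) → Vec V m → Vec W m → V → W
  bind ρ []       []       = ρ
  bind ρ (x ∷ xs) (w ∷ ws) = bind (update ρ x w) xs ws

  bind-cong : ∀ {m ρ ρ' v} (xs : Vec V m) ws → ρ v ≡ ρ' v → bind ρ xs ws v ≡ bind ρ' xs ws v
  bind-cong []       []       e = e
  bind-cong (x ∷ xs) (w ∷ ws) e = bind-cong xs ws (update-cong e)

  bind-replicate-miss : ∀ {m ρ x v} (ws : Vec W m) → v ≢ x → bind ρ (replicate m x) ws v ≡ ρ v
  bind-replicate-miss []       v≢x = refl
  bind-replicate-miss {suc m} {ρ} {x} {v} (w ∷ ws) v≢x =
    trans (bind-replicate-miss ws v≢x) (update-miss ρ w v≢x)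

module _ {W : Set} (F : ℕ → W) where

  names : ∀ m → ℕ → Vec W m
  names zero    l = []
  names (suc m) l = F l ∷ names m (suc l)

-- Canonical forms: bound variables named by depth

module Renaming {V W : Set} (_≟ⱽ_ : DecidableEquality V) (_≟ᵂ_ : DecidableEquality W)
                (Con : Set) (ar : Con → Arity) where
  open Syntax _≟ⱽ_ Con ar
  module Target = Syntax _≟ᵂ_ Con ar

  bind-swapᵛ : ∀ {m} x y (ρ : V → W) (xs : Vec V m) ws v →
               bind _≟ⱽ_ ρ (swapᵛ x y xs) ws (swap x y v) ≡ bind _≟ⱽ_ (ρ ∘ swap x y) xs ws v
  bind-swapᵛ x y ρ []       []       v = refl
  bind-swapᵛ x y ρ (u ∷ us) (w ∷ ws) v =
    trans (bind-swapᵛ x y (update _≟ⱽ_ ρ (swap x y u) w) us ws v) (bind-cong _≟ⱽ_ us ws pointwise)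
    where
    pointwise : update _≟ⱽ_ ρ (swap x y u) w (swap x y v) ≡ update _≟ⱽ_ (ρ ∘ swap x y) u w v
    pointwise with v ≟ⱽ u
    ... | yes refl = update-hit _≟ⱽ_ ρ (swap x y u) w
    ... | no v≢u   = update-miss _≟ⱽ_ ρ w (v≢u ∘ swap-injective x y)

  module _ (F : ℕ → W) where

    -- De Bruijn levels: `l` is the first name not yet in scope. Sibling arguments restart from the
    -- same `l`, so the names issued depend only on the position in the tree.
    canon  : (V → W) → ℕ → Term → Target.Term
    canonᴬ : ∀ {as} → (V → W) → ℕ → Args as → Target.Args as
    canon ρ l (var x)     = var (ρ x)
    canon ρ l star        = star
    canon ρ l (node c as) = node c (canonᴬ ρ l as)
    canonᴬ ρ l [] = []
    canonᴬ ρ l (arg {n} xs t r) =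
      arg (names F n l) (canon (bind _≟ⱽ_ ρ xs (names F n l)) (shift n l) t) (canonᴬ ρ l r)

    canon-cong : ∀ {ρ ρ'} l t → (∀ v → v occurs t → ρ v ≡ ρ' v) → canon ρ l t ≡ canon ρ' l t
    canonᴬ-cong : ∀ {ρ ρ' as} l (r : Args as) → (∀ v → v occursᴬ r → ρ v ≡ ρ' v) →
                  canonᴬ ρ l r ≡ canonᴬ ρ' l r
    canon-cong l (var x)     e = cong var (e x var)
    canon-cong l star        e = refl
    canon-cong l (node c as) e = cong (node c) (canonᴬ-cong l as (λ v p → e v (node p)))
    canonᴬ-cong l [] e = refl
    canonᴬ-cong l (arg {n} xs t r) e = cong₂ (arg _)
      (canon-cong _ t (λ v p → bind-cong _≟ⱽ_ xs (names F n l) (e v (body p))))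
      (canonᴬ-cong l r (λ v p → e v (rest p)))

    canon-chop  : ∀ n ρ l t → Target.chop n (canon ρ l t) ≡ canon ρ l (chop n t)
    canonᴬ-chopᴬ : ∀ {as} n ρ l (r : Args as) → Target.chopᴬ n (canonᴬ ρ l r) ≡ canonᴬ ρ l (chopᴬ n r)
    canon-chop zero    ρ l t           = refl
    canon-chop (suc n) ρ l (var x)     = refl
    canon-chop (suc n) ρ l star        = refl
    canon-chop (suc n) ρ l (node c as) = cong (node c) (canonᴬ-chopᴬ n ρ l as)
    canonᴬ-chopᴬ n ρ l [] = refl
    canonᴬ-chopᴬ n ρ l (arg {b = false} xs t r) =
      cong₂ (arg _) (canon-chop (suc n) _ _ t) (canonᴬ-chopᴬ n ρ l r)
    canonᴬ-chopᴬ n ρ l (arg {b = true} xs t r) =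
      cong₂ (arg _) (canon-chop n _ _ t) (canonᴬ-chopᴬ n ρ l r)

    -- Binders are overwritten by names anyway, so a transposition acts on the canonical form only
    -- through the lookup of variables.
    canon-swap : ∀ x y ρ l t → canon ρ l (swapᵗ x y t) ≡ canon (ρ ∘ swap x y) l t
    canonᴬ-swap : ∀ {as} x y ρ l (r : Args as) →
                  canonᴬ ρ l (swapᴬ x y r) ≡ canonᴬ (ρ ∘ swap x y) l r
    canon-swap x y ρ l (var z)     = refl
    canon-swap x y ρ l star        = refl
    canon-swap x y ρ l (node c as) = cong (node c) (canonᴬ-swap x y ρ l as)
    canonᴬ-swap x y ρ l [] = refl
    canonᴬ-swap x y ρ l (arg {n} xs t r) = cong₂ (arg _)
      (trans (canon-swap x y _ _ t)
             (canon-cong _ t (λ v _ → bind-swapᵛ x y ρ xs (names F n l) v)))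
      (canonᴬ-swap x y ρ l r)

    canon-perm : ∀ {m} (xs zs : Vec V m) ρ l t →
                 canon ρ l (permᵗ xs zs t) ≡ canon (ρ ∘ permᵛ xs zs) l t
    canon-perm []       []       ρ l t = refl
    canon-perm (x ∷ xs) (z ∷ zs) ρ l t =
      trans (canon-swap x z ρ l (permᵗ xs zs t)) (canon-perm xs zs (ρ ∘ swap x z) l t)

-- Composition of two renamings

module Composition {V W X : Set} (_≟ⱽ_ : DecidableEquality V) (_≟ᵂ_ : DecidableEquality W)
                   (_≟ˣ_ : DecidableEquality X) (Con : Set) (ar : Con → Arity) where
  open Syntax _≟ⱽ_ Con ar
  module Mid = Syntax _≟ᵂ_ Con ar

  -- Capture avoidance: distinct `ws` keep the binders apart, and `ρ v` outside `ws` keeps a free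
  -- `v` from being mistaken for a bound one.
  bind-∘ : ∀ {m} (ρ' : W → X) (ρ : V → W) (xs : Vec V m) (ws : Vec W m) (us : Vec X m) v →
           Mid.Distinctᵛ ws → ¬ ρ v Mid.∈ᵛ ws →
           bind _≟ᵂ_ ρ' ws us (bind _≟ⱽ_ ρ xs ws v) ≡ bind _≟ⱽ_ (ρ' ∘ ρ) xs us v
  bind-∘ ρ' ρ []       []       []       v _          _ = refl
  bind-∘ ρ' ρ (x ∷ xs) (w ∷ ws) (u ∷ us) v (w∉ws , d) ρv∉ws =
    trans (bind-∘ (update _≟ᵂ_ ρ' w u) (update _≟ⱽ_ ρ x w) xs ws us v d avoids)
          (bind-cong _≟ⱽ_ xs us pointwise)
    where
    avoids : ¬ update _≟ⱽ_ ρ x w v Mid.∈ᵛ ws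
    avoids with v ≟ⱽ x
    ... | yes _ = w∉ws
    ... | no _  = λ p → ρv∉ws (there p)
    pointwise : update _≟ᵂ_ ρ' w u (update _≟ⱽ_ ρ x w v) ≡ update _≟ⱽ_ (ρ' ∘ ρ) x u v
    pointwise with v ≟ⱽ x
    ... | yes _ = update-hit _≟ᵂ_ ρ' w u
    ... | no _  = update-miss _≟ᵂ_ ρ' u (λ { refl → ρv∉ws here })

  module _ (F : ℕ → W) (F-injective : ∀ j k → F j ≡ F k → j ≡ k) (G : ℕ → X) where
    module R₁ = Renaming _≟ⱽ_ _≟ᵂ_ Con ar
    module R₂ = Renaming _≟ᵂ_ _≟ˣ_ Con ar
    module R₃ = Renaming _≟ⱽ_ _≟ˣ_ Con ar

    ∈names : ∀ m l {w} → w Mid.∈ᵛ names F m l → ∃[ j ] l ≤ j × w ≡ F j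
    ∈names (suc m) l here = l , ≤-refl , refl
    ∈names (suc m) l (there p) with ∈names m (suc l) p
    ... | j , l<j , e = j , ≤-trans (n≤1+n l) l<j , e

    names-distinct : ∀ m l → Mid.Distinctᵛ (names F m l)
    names-distinct zero    l = tt
    names-distinct (suc m) l = fresh , names-distinct m (suc l)
      where
      fresh : ¬ F l Mid.∈ᵛ names F m (suc l)
      fresh p with ∈names m (suc l) p
      ... | j , l<j , e = <⇒≢ l<j (F-injective l j e)

    -- A value of the extended environment is either an old one, which avoids all names from `l` on,
    -- or a name just issued, which lies below the new level.
    bind-avoids : ∀ {m} l (ρ : V → W) (xs : Vec V m) v → (∀ j → l ≤ j → ρ v ≢ F j) →
                  ∀ j → shift m l ≤ j → bind _≟ⱽ_ ρ xs (names F m l) v ≢ F j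
    bind-avoids l ρ []       v av = av
    bind-avoids l ρ (x ∷ xs) v av = bind-avoids (suc l) (update _≟ⱽ_ ρ x (F l)) xs v avoids
      where
      avoids : ∀ j → suc l ≤ j → update _≟ⱽ_ ρ x (F l) v ≢ F j
      avoids j l<j with v ≟ⱽ x
      ... | yes _ = λ e → <⇒≢ l<j (F-injective l j e)
      ... | no _  = av j (≤-trans (n≤1+n l) l<j)

    -- Names below `l` are already in scope and may be values of `ρ`; only names still to be issued
    -- could capture something. For `ρ = id` this says that renaming with fresh names leaves the
    -- normal form unchanged.
    canon-canon : ∀ ρ' ρ l t → (∀ v → v occurs t → ∀ j → l ≤ j → ρ v ≢ F j) →
                  R₂.canon G ρ' l (R₁.canon F ρ l t) ≡ R₃.canon G (ρ' ∘ ρ) l t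
    canonᴬ-canonᴬ : ∀ {as} ρ' ρ l (r : Args as) → (∀ v → v occursᴬ r → ∀ j → l ≤ j → ρ v ≢ F j) →
                    R₂.canonᴬ G ρ' l (R₁.canonᴬ F ρ l r) ≡ R₃.canonᴬ G (ρ' ∘ ρ) l r
    canon-canon ρ' ρ l (var x)     av = refl
    canon-canon ρ' ρ l star        av = refl
    canon-canon ρ' ρ l (node c as) av =
      cong (node c) (canonᴬ-canonᴬ ρ' ρ l as (λ v p → av v (node p)))
    canonᴬ-canonᴬ ρ' ρ l [] av = refl
    canonᴬ-canonᴬ ρ' ρ l (arg {n} xs t r) av = cong₂ (arg _)
      (trans
        (canon-canon _ _ _ t (λ v p → bind-avoids l ρ xs v (av v (body p))))
        (R₃.canon-cong G _ t λ v p →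
          bind-∘ ρ' ρ xs (names F n l) (names G n l) v (names-distinct n l)
            (λ q → let (j , l≤j , e) = ∈names n l q in av v (body p) j l≤j e)))
      (canonᴬ-canonᴬ ρ' ρ l r (λ v p → av v (rest p)))

-- α-equivalent terms have equal canonical forms

module Soundness {V W : Set} (_≟ⱽ_ : DecidableEquality V) (_≟ᵂ_ : DecidableEquality W)
                 (Con : Set) (ar : Con → Arity) (F : ℕ → W) where
  open Syntax _≟ⱽ_ Con ar
  open Renaming _≟ⱽ_ _≟ᵂ_ Con ar
  open Composition _≟ⱽ_ _≟ⱽ_ _≟ᵂ_ Con ar using (bind-∘)

  swap-bind : ∀ {m} x y ρ (xs zs : Vec V m) v → ¬ x ∈ᵛ zs → ¬ y ∈ᵛ zs →
              swap x y (bind _≟ⱽ_ ρ xs zs v) ≡ bind _≟ⱽ_ (swap x y ∘ ρ) xs zs v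
  swap-bind x y ρ []       []       v x∉ y∉ = refl
  swap-bind x y ρ (u ∷ us) (z ∷ zs) v x∉ y∉ =
    trans (swap-bind x y (update _≟ⱽ_ ρ u z) us zs v (x∉ ∘ there) (y∉ ∘ there))
          (bind-cong _≟ⱽ_ us zs pointwise)
    where
    pointwise : swap x y (update _≟ⱽ_ ρ u z v) ≡ update _≟ⱽ_ (swap x y ∘ ρ) u z v
    pointwise with v ≟ⱽ u
    ... | yes _ = swap-fixes (λ { refl → x∉ here }) (λ { refl → y∉ here })
    ... | no _  = refl

  -- Transpositions also send the `zs` back to the `xs`; away from fresh `zs` this is invisible and
  -- their product is a simultaneous substitution.
  permᵛ-bind : ∀ {m} (xs zs : Vec V m) v → Distinctᵛ zs → (∀ z → z ∈ᵛ zs → ¬ z ∈ᵛ xs) → ¬ v ∈ᵛ zs →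
               permᵛ xs zs v ≡ bind _≟ⱽ_ id xs zs v
  permᵛ-bind []       []       v _          _       _    = refl
  permᵛ-bind (x ∷ xs) (z ∷ zs) v (z∉zs , d) zs∩xs=∅ v∉zs =
    trans (cong (swap x z) (permᵛ-bind xs zs v d (λ u p q → zs∩xs=∅ u (there p) (there q)) (v∉zs ∘ there)))
    (trans (swap-bind x z id xs zs v (λ p → zs∩xs=∅ x (there p) here) z∉zs)
           (bind-cong _≟ⱽ_ xs zs pointwise))
    where
    pointwise : swap x z v ≡ update _≟ⱽ_ id x z v
    pointwise with v ≟ⱽ x
    ... | yes refl = refl
    ... | no _ with v ≟ⱽ z
    ...   | yes refl = ⊥-elim (v∉zs here)
    ...   | no _ = refl

  -- Renaming `xs` to fresh `zs` and then binding `zs` amounts to binding `xs`. Both sides of the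
  -- α-rule thus meet at the same `zs`, which serves soundness and, read backwards, completeness.
  canon-perm-fresh : ∀ {m} (xs zs : Vec V m) ρ ws l t →
    Distinctᵛ zs → (∀ z → z ∈ᵛ zs → ¬ z ∈ᵛ xs) → (∀ z → z ∈ᵛ zs → ¬ z occurs t) →
    canon F (bind _≟ⱽ_ ρ zs ws) l (permᵗ xs zs t) ≡ canon F (bind _≟ⱽ_ ρ xs ws) l t
  canon-perm-fresh xs zs ρ ws l t d zs∩xs=∅ zs∩t=∅ =
    trans (canon-perm F xs zs _ l t)
          (canon-cong F l t λ v p →
             let v∉zs = λ q → zs∩t=∅ v q p in
             trans (cong (bind _≟ⱽ_ ρ zs ws) (permᵛ-bind xs zs v d zs∩xs=∅ v∉zs))
                   (bind-∘ ρ id xs zs ws v d v∉zs))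

  sound  : ∀ {t u} → t ≈ u → ∀ ρ l → canon F ρ l t ≡ canon F ρ l u
  soundᴬ : ∀ {as} {r r' : Args as} → r ≈ᴬ r' → ∀ ρ l → canonᴬ F ρ l r ≡ canonᴬ F ρ l r'
  sound var      ρ l = refl
  sound star     ρ l = refl
  sound (node p) ρ l = cong (node _) (soundᴬ p ρ l)
  soundᴬ [] ρ l = refl
  soundᴬ (arg {n} {xs = xs} {ys} {t} {u} (zs , (d , fresh) , p) q) ρ l = cong₂ (arg _)
    (trans (sym (canon-perm-fresh xs zs ρ _ _ t d
                  (λ z z∈ → proj₁ (fresh z z∈)) (λ z z∈ → proj₁ (proj₂ (proj₂ (fresh z z∈))))))
    (trans (sound p (bind _≟ⱽ_ ρ zs (names F n l)) (shift n l))
           (canon-perm-fresh ys zs ρ _ _ u d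
                  (λ z z∈ → proj₁ (proj₂ (fresh z z∈))) (λ z z∈ → proj₂ (proj₂ (proj₂ (fresh z z∈)))))))
    (soundᴬ q ρ l)

-- The injective sequence meets each entry of `L` at most once, so some tail of it avoids `L`;
-- excluded middle tells whether an entry is met at all.
fresh-variable : ∀ {V : Set} → ExcludedMiddle 0ℓ → Infinite V → (L : List V) → ∃[ z ] ¬ z ∈ L
fresh-variable {V} em (f , f-injective) L = let (N , p) = tail-avoids L in f N , p N ≤-refl
  where
  tail-avoids : (L : List V) → ∃[ N ] (∀ n → N ≤ n → ¬ f n ∈ L)
  tail-avoids [] = 0 , λ _ _ ()
  tail-avoids (a ∷ L) with tail-avoids L | em {∃[ n ] f n ≡ a}
  ... | N , p | no a∉f =
    N , λ { n _ (here e) → a∉f (n , e) ; n N≤n (there q) → p n N≤n q }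
  ... | N , p | yes (k , refl) =
    suc k ⊔ N ,
    λ { n M≤n (here e)  → <⇒≢ (≤-trans (m≤m⊔n (suc k) N) M≤n) (sym (f-injective n k e))
      ; n M≤n (there q) → p n (≤-trans (m≤n⊔m (suc k) N) M≤n) q }

-- Equal normal forms imply α-equivalence

module Completeness {V : Set} (_≟_ : DecidableEquality V) (Con : Set) (ar : Con → Arity)
                    (fresh : (L : List V) → ∃[ z ] ¬ z ∈ L) where
  open Syntax _≟_ Con ar

  _≟'_ : DecidableEquality (V ⊎ ℕ)
  _≟'_ = ≡-dec _≟_ ℕ._≟_

  open Renaming _≟_ _≟'_ Con ar
  open Soundness _≟_ _≟'_ Con ar inj₂

  fresh-vector : ∀ m (L : List V) →
                 Σ (Vec V m) λ zs → Distinctᵛ zs × (∀ z → z ∈ᵛ zs → ¬ z ∈ L)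
  fresh-vector zero    L = [] , tt , λ _ ()
  fresh-vector (suc m) L with fresh L
  ... | z , z∉L with fresh-vector m (z ∷ L)
  ...   | zs , d , zs∩L=∅ =
    z ∷ zs , ((λ p → zs∩L=∅ z p (here refl)) , d) ,
    λ { _ here → z∉L ; y (there p) q → zs∩L=∅ y p (there q) }

  record Faithful (ρ : V → V ⊎ ℕ) (l : ℕ) : Set where
    field
      injective : ∀ {u v} → ρ u ≡ ρ v → u ≡ v
      avoids    : ∀ {v j} → l ≤ j → ρ v ≢ inj₂ j
  open Faithful

  update-faithful : ∀ {ρ l} x → Faithful ρ l → Faithful (update _≟_ ρ x (inj₂ l)) (suc l)
  update-faithful {ρ} {l} x φ .injective {u} {v} e with u ≟ x | v ≟ x
  ... | yes refl | yes refl = refl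
  ... | yes _    | no _     = ⊥-elim (avoids φ ≤-refl (sym e))
  ... | no _     | yes _    = ⊥-elim (avoids φ ≤-refl e)
  ... | no _     | no _     = injective φ e
  update-faithful {ρ} {l} x φ .avoids {v} l<j e with v ≟ x
  ... | yes _ = <⇒≢ l<j (inj₂-injective e)
  ... | no _  = avoids φ (≤-trans (n≤1+n l) l<j) e

  bind-faithful : ∀ {m ρ l} (xs : Vec V m) → Faithful ρ l →
                  Faithful (bind _≟_ ρ xs (names inj₂ m l)) (shift m l)
  bind-faithful []       φ = φ
  bind-faithful (x ∷ xs) φ = bind-faithful xs (update-faithful x φ)

  -- Stated for variable argument lists so that `refl` can be matched; in its uses one side is a
  -- `canonᴬ` expression, whose arity is transported along the equality of constructors.
  node-injective : ∀ {c c'} {r : Target.Args (ar c)} {r' : Target.Args (ar c')} →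
                   FT.node c r ≡ node c' r' → Σ (c' ≡ c) λ e → r ≡ subst (Target.Args ∘ ar) e r'
  node-injective refl = refl , refl

  first-body : ∀ {n b as} → Target.Args ((n , b) ∷ as) → Target.Term
  first-body (arg _ t _) = t

  other-args : ∀ {n b as} → Target.Args ((n , b) ∷ as) → Target.Args as
  other-args (arg _ _ r) = r

  -- The recursion is on the common normal form, since permᵗ xs zs t is not a subterm.
  complete′ : ∀ (c : Target.Term) t u {ρ l} → Faithful ρ l →
              c ≡ canon inj₂ ρ l t → c ≡ canon inj₂ ρ l u → t ≈ u
  completeᴬ′ : ∀ {as} (cs : Target.Args as) (r r' : Args as) {ρ l} → Faithful ρ l →
               cs ≡ canonᴬ inj₂ ρ l r → cs ≡ canonᴬ inj₂ ρ l r' → r ≈ᴬ r'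
  complete′ (var _) (var x) (var y) φ e e' with injective φ (var-injective (trans (sym e) e'))
    where
    var-injective : ∀ {v w : V ⊎ ℕ} → FT.var {_} {_≟'_} {Con} {ar} v ≡ var w → v ≡ w
    var-injective refl = refl
  ... | refl = var
  complete′ star star star φ _ _ = star
  complete′ (node c cs) (node _ as) (node _ bs) φ e e' with node-injective e | node-injective e'
  ... | refl , p | refl , q = node (completeᴬ′ cs as bs φ p q)
  completeᴬ′ [] [] [] φ _ _ = []
  completeᴬ′ (arg ws c cs) (arg {n} xs t r) (arg ys u r') {ρ} {l} φ e e'
    -- Packing both arguments into one list makes a single `zs` fresh for `xs`, `ys`, `t` and `u`;
    -- the flags `true` are arbitrary.
    with fresh-vector n (varsᴬ {(n , true) ∷ (n , true) ∷ []} (arg xs t (arg ys u [])))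
  ... | zs , d , new =
    arg (zs , (d , λ z p → (z∉xs z p , z∉ys z p , z∉t z p , z∉u z p)) ,
         complete′ c (permᵗ xs zs t) (permᵗ ys zs u) (bind-faithful zs φ)
           (trans (cong first-body e) (sym (canon-perm-fresh xs zs ρ _ _ t d z∉xs z∉t)))
           (trans (cong first-body e') (sym (canon-perm-fresh ys zs ρ _ _ u d z∉ys z∉u))))
        (completeᴬ′ cs r r' φ (cong other-args e) (cong other-args e'))
    where
    both : Args ((n , true) ∷ (n , true) ∷ [])
    both = arg xs t (arg ys u [])
    z∉xs : ∀ z → z ∈ᵛ zs → ¬ z ∈ᵛ xs
    z∉xs z p q = new z p (occurs⇒∈varsᴬ {r = both} (binder q))
    z∉ys : ∀ z → z ∈ᵛ zs → ¬ z ∈ᵛ ys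
    z∉ys z p q = new z p (occurs⇒∈varsᴬ {r = both} (rest (binder q)))
    z∉t : ∀ z → z ∈ᵛ zs → ¬ z occurs t
    z∉t z p q = new z p (occurs⇒∈varsᴬ {r = both} (body q))
    z∉u : ∀ z → z ∈ᵛ zs → ¬ z occurs u
    z∉u z p q = new z p (occurs⇒∈varsᴬ {r = both} (rest (body q)))

  normal : Term → Target.Term
  normal = canon inj₂ inj₁ 0

  complete : ∀ {t u} → normal t ≡ normal u → t ≈ u
  complete {t} {u} e = complete′ (normal t) t u φ refl e
    where
    φ : Faithful inj₁ 0
    φ .injective = inj₁-injective
    φ .avoids _ ()

  sound-normal : ∀ {t u} → t ≈ u → normal t ≡ normal u
  sound-normal p = sound p inj₁ 0

-- The canonical injection, and surjectivity from fresh names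

module Completion {V : Set} (_≟_ : DecidableEquality V) (Con : Set) (ar : Con → Arity)
                  (em : ExcludedMiddle 0ℓ) (V-infinite : Infinite V) where
  open Syntax _≟_ Con ar
  open Completeness _≟_ Con ar (fresh-variable em V-infinite)
  open Renaming _≟_ _≟'_ Con ar using (module Target)

  MixedTerm = Mixed V _≟_ Con ar
  infix 4 _↝_ _∼′_
  _↝_ = Represents V _≟_ Con ar
  _∼′_ = _∼_ V _≟_ Con ar

  v₀ : V
  v₀ = proj₁ V-infinite 0

  -- The completion consists of star-free terms. In an approximant of precision `n` every `star`
  -- sits where `chop n` cuts, so its replacement disappears again.
  fill  : Term → Term
  fillᴬ : ∀ {as} → Args as → Args as
  fill (var x)     = var x
  fill star        = var v₀
  fill (node c as) = node c (fillᴬ as)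
  fillᴬ []           = []
  fillᴬ (arg xs t r) = arg xs (fill t) (fillᴬ r)

  fill-star-free  : ∀ t → StarFree V _≟_ Con ar (fill t)
  fillᴬ-star-free : ∀ {as} (r : Args as) → StarFreeA V _≟_ Con ar (fillᴬ r)
  fill-star-free (var x)     = var
  fill-star-free star        = var
  fill-star-free (node c as) = node (fillᴬ-star-free as)
  fillᴬ-star-free []           = []
  fillᴬ-star-free (arg xs t r) = arg (fill-star-free t) (fillᴬ-star-free r)

  chop-fill  : ∀ {n t} → Level V _≟_ Con ar n t → chop n (fill t) ≡ t
  chopᴬ-fillᴬ : ∀ {n as} {r : Args as} → LevelA V _≟_ Con ar n r → chopᴬ n (fillᴬ r) ≡ r
  chop-fill cut      = refl
  chop-fill var      = refl
  chop-fill (node p) = cong (node _) (chopᴬ-fillᴬ p)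
  chopᴬ-fillᴬ []        = refl
  chopᴬ-fillᴬ (ind p q) = cong₂ (arg _) (chop-fill p) (chopᴬ-fillᴬ q)
  chopᴬ-fillᴬ (coi p q) = cong₂ (arg _) (chop-fill p) (chopᴬ-fillᴬ q)

  chop-level  : ∀ n {t} → StarFree V _≟_ Con ar t → Level V _≟_ Con ar n (chop n t)
  chopᴬ-level : ∀ n {as} {r : Args as} → StarFreeA V _≟_ Con ar r → LevelA V _≟_ Con ar n (chopᴬ n r)
  chop-level zero    p        = cut
  chop-level (suc n) var      = var
  chop-level (suc n) (node p) = node (chopᴬ-level n p)
  chopᴬ-level n [] = []
  chopᴬ-level n (arg {b = false} p q) = ind (chop-level (suc n) p) (chopᴬ-level n q)
  chopᴬ-level n (arg {b = true}  p q) = coi (chop-level n p) (chopᴬ-level n q)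

  chop-approx : ∀ (t : MixedTerm) {n k} → n ≤ k → chop n (approx t k) ≡ approx t n
  chop-approx t {n} n≤k = go (≤⇒≤′ n≤k)
    where
    go : ∀ {k} → n ≤′ k → chop n (approx t k) ≡ approx t n
    go ≤′-refl = begin
      chop n (approx t n)                ≡⟨ cong (chop n) (coherent t n) ⟨
      chop n (chop n (approx t (suc n))) ≡⟨ chop-chop _ ≤-refl ⟩
      chop n (approx t (suc n))          ≡⟨ coherent t n ⟩
      approx t n                         ∎
      where open ≡-Reasoning
    go (≤′-step {k} p) = begin
      chop n (approx t (suc k))          ≡⟨ chop-chop _ (≤′⇒≤ p) ⟨
      chop n (chop k (approx t (suc k))) ≡⟨ cong (chop n) (coherent t k) ⟩
      chop n (approx t k)                ≡⟨ go p ⟩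
      approx t n                         ∎
      where open ≡-Reasoning

  finite-approximants : (t : MixedTerm) → t ↝ (fill ∘ approx t)
  finite-approximants t = (λ k → fill-star-free (approx t k)) , λ n → n , λ k n≤k → begin
    chop n (fill (approx t k))          ≡⟨ chop-chop _ n≤k ⟨
    chop n (chop k (fill (approx t k))) ≡⟨ cong (chop n) (chop-fill (level t k)) ⟩
    chop n (approx t k)                 ≡⟨ chop-approx t n≤k ⟩
    approx t n                          ∎
    where open ≡-Reasoning

  well-defined : ∀ t u s s' → _≈α∞_ V _≟_ Con ar t u → t ↝ s → u ↝ s' → s ∼′ s'
  well-defined t u s s' t≈u (_ , s→t) (_ , s'→u) n with s→t n | s'→u n
  ... | N , p | N' , p' = N ⊔ N' , λ k M≤k →
    subst₂ _≈_ (sym (p k (≤-trans (m≤m⊔n N N') M≤k))) (sym (p' k (≤-trans (m≤n⊔m N N') M≤k))) (t≈u n)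

  approx-≈ : ∀ t {s s'} → t ↝ s → s ∼′ s' → ∀ n → ∃[ N ] (∀ k → N ≤ k → approx t n ≈ chop n (s' k))
  approx-≈ t (_ , s→t) s∼s' n with s→t n | s∼s' n
  ... | N , p | N' , p' = N ⊔ N' , λ k M≤k →
    subst (_≈ _) (p k (≤-trans (m≤m⊔n N N') M≤k)) (p' k (≤-trans (m≤n⊔m N N') M≤k))

  -- One index beyond both thresholds suffices: convergence to `u` gives an equality of truncations,
  -- along which the α-equivalence with `t` is transported.
  injective : ∀ t u s s' → t ↝ s → u ↝ s' → s ∼′ s' → _≈α∞_ V _≟_ Con ar t u
  injective t u s s' t↝s (_ , s'→u) s∼s' n with approx-≈ t t↝s s∼s' n | s'→u n
  ... | N , p | N' , p' =
    subst (_ ≈_) (p' (N ⊔ N') (m≤n⊔m N N')) (p (N ⊔ N') (m≤m⊔n N N'))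

  module _ (F : ℕ → V) (F-injective : ∀ j k → F j ≡ F k → j ≡ k) where
    open Renaming _≟_ _≟_ Con ar using () renaming
      (canon to rename; canonᴬ to renameᴬ; canon-chop to rename-chop)
    open Soundness _≟_ _≟_ Con ar F using () renaming (sound to rename-sound)
    open Composition _≟_ _≟_ _≟'_ Con ar using (canon-canon)

    rename-level : ∀ {n t} ρ l → Level V _≟_ Con ar n t → Level V _≟_ Con ar n (rename F ρ l t)
    renameᴬ-level : ∀ {n as} {r : Args as} ρ l →
                    LevelA V _≟_ Con ar n r → LevelA V _≟_ Con ar n (renameᴬ F ρ l r)
    rename-level ρ l cut      = cut
    rename-level ρ l var      = var
    rename-level ρ l (node p) = node (renameᴬ-level ρ l p)
    renameᴬ-level ρ l []        = []
    renameᴬ-level ρ l (ind p q) = ind (rename-level _ _ p) (renameᴬ-level ρ l q)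
    renameᴬ-level ρ l (coi p q) = coi (rename-level _ _ p) (renameᴬ-level ρ l q)

    -- Naming the bound variables by their depth makes the truncations of a
    -- Cauchy sequence cohere on the nose and not merely up to α-equivalence.
    surjective : ∀ s → FiniteSeq V _≟_ Con ar s → (c : Cauchy V _≟_ Con ar s) →
                 (∀ n v → v occurs chop n (s (proj₁ (c n))) → ∀ j → v ≢ F j) →
                 ∃[ t ] ∃[ s' ] (t ↝ s' × s' ∼′ s)
    surjective s s-finite cauchy F-fresh =
      limit , fill ∘ approx limit , finite-approximants limit , converges
      where
      open ≡-Reasoning

      N : ℕ → ℕ
      N n = proj₁ (cauchy n)

      stable : ∀ n k → N n ≤ k → rename F id 0 (chop n (s (N n))) ≡ rename F id 0 (chop n (s k))
      stable n k p = rename-sound (proj₂ (cauchy n) (N n) k ≤-refl p) id 0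

      limit : MixedTerm
      limit .approx n = rename F id 0 (chop n (s (N n)))
      limit .level n = rename-level id 0 (chop-level n (s-finite (N n)))
      limit .coherent n = begin
        chop n (rename F id 0 (chop (suc n) (s (N (suc n)))))
          ≡⟨ cong (chop n) (stable (suc n) K (m≤n⊔m (N n) (N (suc n)))) ⟩
        chop n (rename F id 0 (chop (suc n) (s K)))
          ≡⟨ rename-chop F n id 0 (chop (suc n) (s K)) ⟩
        rename F id 0 (chop n (chop (suc n) (s K)))
          ≡⟨ cong (rename F id 0) (chop-chop (s K) (n≤1+n n)) ⟩
        rename F id 0 (chop n (s K))
          ≡⟨ stable n K (m≤m⊔n (N n) (N (suc n))) ⟨
        rename F id 0 (chop n (s (N n))) ∎
        where
        -- A common index, late enough for both precisions, so that both representatives are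
        -- exchanged for truncations of the same term.
        K : ℕ
        K = N n ⊔ N (suc n)

      converges : (fill ∘ approx limit) ∼′ s
      converges n with proj₂ (finite-approximants limit) n
      ... | M , p = M ⊔ N n , λ k M'≤k → complete (begin
        normal (chop n (fill (approx limit k)))
          ≡⟨ cong normal (p k (≤-trans (m≤m⊔n M (N n)) M'≤k)) ⟩
        normal (rename F id 0 (chop n (s (N n))))
          -- Freshness enters here: no variable of the representative is one of the names, so
          -- renaming has captured nothing.
          ≡⟨ canon-canon F F-injective inj₂ inj₁ id 0 _ (λ v q j _ → F-fresh n v q j) ⟩
        normal (chop n (s (N n)))
          ≡⟨ sound-normal (proj₂ (cauchy n) (N n) k ≤-refl (≤-trans (m≤n⊔m M (N n)) M'≤k)) ⟩
        normal (chop n (s k)) ∎)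

-- Countable unions, and fresh sequences in an uncountable set

advance : ℕ × ℕ → ℕ × ℕ
advance (zero  , b) = suc b , zero
advance (suc a , b) = a , suc b

-- Cantor's enumeration: each antidiagonal is walked from `(n , 0)` to `(0 , n)`, after which
-- `advance` jumps to `(suc n , 0)`.
diagonal : ℕ → ℕ × ℕ
diagonal zero    = zero , zero
diagonal (suc k) = advance (diagonal k)

diagonal-surjective : ∀ a b → ∃[ k ] diagonal k ≡ (a , b)
diagonal-surjective a b = let (k , e) = axis (b + a) in along b a k e
  where
  along : ∀ b a k → diagonal k ≡ (b + a , 0) → ∃[ j ] diagonal j ≡ (a , b)
  along zero    a k e = k , e
  along (suc b) a k e with along b (suc a) k (trans e (cong (_, 0) (sym (+-suc b a))))
  ... | j , e' = suc j , cong advance e'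

  axis : ∀ n → ∃[ k ] diagonal k ≡ (n , 0)
  axis zero    = zero , refl
  axis (suc n) with axis n
  ... | k , e with along n 0 k (trans e (cong (_, 0) (sym (+-identityʳ n))))
  ...   | j , e' = suc j , cong advance e'

module _ {A : Set} where

  nth : A → List A → ℕ → A
  nth d []       _       = d
  nth d (x ∷ xs) zero    = x
  nth d (x ∷ xs) (suc i) = nth d xs i

  ∈⇒nth : ∀ {d x} {xs : List A} → x ∈ xs → ∃[ i ] nth d xs i ≡ x
  ∈⇒nth (here refl) = zero , refl
  ∈⇒nth (there p) with ∈⇒nth p
  ... | i , e = suc i , e

  -- Positions past the end of a list yield `d`; this extra value is harmless, as the enumeration is
  -- only used as something to avoid.
  enumerate-union : A → (ℕ → List A) → ℕ → A
  enumerate-union d L k = nth d (L (proj₁ (diagonal k))) (proj₂ (diagonal k))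

  ∈⇒enumerate-union : ∀ d L n {x} → x ∈ L n → ∃[ k ] enumerate-union d L k ≡ x
  ∈⇒enumerate-union d L n p with ∈⇒nth {d} p
  ... | i , e with diagonal-surjective n i
  ...   | k , e' rewrite sym e = k , cong (λ ni → nth d (L (proj₁ ni)) (proj₂ ni)) e'

  prepend : List A → (ℕ → A) → ℕ → A
  prepend []       f         = f
  prepend (x ∷ xs) f zero    = x
  prepend (x ∷ xs) f (suc k) = prepend xs f k

  prepend-tail : ∀ xs f k → ∃[ j ] prepend xs f j ≡ f k
  prepend-tail []       f k = k , refl
  prepend-tail (x ∷ xs) f k with prepend-tail xs f k
  ... | j , e = suc j , e

  prepend-head : ∀ {xs x} f → x ∈ xs → ∃[ j ] prepend xs f j ≡ x
  prepend-head f (here refl) = zero , refl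
  prepend-head f (there p) with prepend-head f p
  ... | j , e = suc j , e

  outside : ExcludedMiddle 0ℓ → Uncountable A → (f : ℕ → A) → ∃[ a ] (∀ k → f k ≢ a)
  outside em uncountable f with em {∃[ a ] (∀ k → f k ≢ a)}
  ... | yes p = p
  ... | no ¬p = ⊥-elim (uncountable (inj₂ (f , hit)))
    where
    hit : ∀ a → ∃[ k ] f k ≡ a
    hit a with em {∃[ k ] f k ≡ a}
    ... | yes q = q
    ... | no ¬q = ⊥-elim (¬p (a , λ k e → ¬q (k , e)))

  module _ (em : ExcludedMiddle 0ℓ) (uncountable : Uncountable A) (f : ℕ → A) where

    -- A sequence with finitely many elements prepended is still a sequence, so `outside` yields an
    -- element off `f` and off all earlier choices at once.
    previous : ℕ → List A
    new      : ℕ → A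
    previous zero    = []
    previous (suc k) = new k ∷ previous k
    new k = proj₁ (outside em uncountable (prepend (previous k) f))

    new-outside : ∀ k → ∀ j → prepend (previous k) f j ≢ new k
    new-outside k = proj₂ (outside em uncountable (prepend (previous k) f))

    new∉f : ∀ k j → f j ≢ new k
    new∉f k j e = let (i , e') = prepend-tail (previous k) f j in new-outside k i (trans e' e)

    new∈previous : ∀ {j k} → j < k → new j ∈ previous k
    new∈previous (s≤s j≤k) = go j≤k
      where
      go : ∀ {j k} → j ≤ k → new j ∈ new k ∷ previous k
      go {j} {k} j≤k with m≤n⇒m<n∨m≡n j≤k
      go j≤k | inj₂ refl = here refl
      go j≤k | inj₁ (s≤s j≤k') = there (go j≤k')

    new-distinct : ∀ {j k} → j < k → new j ≢ new k
    new-distinct {j} {k} j<k e =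
      let (i , e') = prepend-head f (new∈previous j<k) in new-outside k i (trans e' e)

    new-injective : ∀ j k → new j ≡ new k → j ≡ k
    new-injective j k e with <-cmp j k
    ... | tri< j<k _ _ = ⊥-elim (new-distinct j<k e)
    ... | tri≈ _ j≡k _ = j≡k
    ... | tri> _ _ k<j = ⊥-elim (new-distinct k<j (sym e))

module UncountableVariables {V : Set} (_≟_ : DecidableEquality V) (Con : Set) (ar : Con → Arity)
  (em : ExcludedMiddle 0ℓ) (V-infinite : Infinite V) (uncountable : Uncountable V) where
  open Syntax _≟_ Con ar
  open Completion _≟_ Con ar em V-infinite

  bijective : CanonicalInjectionBijective V _≟_ Con ar
  bijective =
    (λ t → _ , finite-approximants t) ,
    well-defined ,
    injective ,
    λ s s-finite cauchy →
      -- One representative per precision is enough: `limit` renames exactly these, and later terms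
      -- are compared with them through the Cauchy condition.
      let truncation-vars = λ n → vars (chop n (s (proj₁ (cauchy n))))
          e = enumerate-union (proj₁ V-infinite 0) truncation-vars
      in surjective (new em uncountable e) (new-injective em uncountable e) s s-finite cauchy
           λ n v p j v≡Fj →
             let (k , ek≡v) = ∈⇒enumerate-union _ truncation-vars n (occurs⇒∈vars p)
             in new∉f em uncountable e j k (trans ek≡v v≡Fj)

-- Building and reading argument lists of arbitrary arity

module _ {A : Set} {n : ℕ} where

  put : Fin n → A → (Fin n → A) → Fin n → A
  put i a h j with j Fin.≟ i
  ... | yes _ = a
  ... | no _  = h j

  put-hit : ∀ i {a} h → put i a h i ≡ a
  put-hit i h with i Fin.≟ i
  ... | yes _  = refl
  ... | no i≢i = ⊥-elim (i≢i refl)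

  put-miss : ∀ {i j} {a} h → j ≢ i → put i a h j ≡ h j
  put-miss {i} {j} h j≢i with j Fin.≟ i
  ... | yes j≡i = ⊥-elim (j≢i j≡i)
  ... | no _    = refl

  -- `R` depends on the position because the truncation budget does; a unary predicate is covered by
  -- ignoring one of the two values.
  put-rel : ∀ (R : Fin n → A → A → Set) i {a a' h h'} → R i a a' → (∀ j → R j (h j) (h' j)) →
            ∀ j → R j (put i a h j) (put i a' h' j)
  put-rel R i r rs j with j Fin.≟ i
  ... | yes refl = r
  ... | no _     = rs j

budget : Bool → ℕ → ℕ
budget false n = suc n
budget true  n = n

n≤budget : ∀ b {n} → n ≤ budget b n
n≤budget false = n≤1+n _
n≤budget true  = ≤-refl

module ArgumentAccess {V : Set} (_≟_ : DecidableEquality V) (Con : Set) (ar : Con → Arity) where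
  open Syntax _≟_ Con ar

  binders : ∀ {as} → Args as → (i : Fin (length as)) → Vec V (proj₁ (lookup as i))
  binders (arg xs t r) zero    = xs
  binders (arg xs t r) (suc i) = binders r i

  bodyAt : ∀ {as} → Args as → Fin (length as) → Term
  bodyAt (arg xs t r) zero    = t
  bodyAt (arg xs t r) (suc i) = bodyAt r i

  Args-ext : ∀ {as} (r r' : Args as) → (∀ i → binders r i ≡ binders r' i) →
             (∀ i → bodyAt r i ≡ bodyAt r' i) → r ≡ r'
  Args-ext []           []             e e' = refl
  Args-ext (arg xs t r) (arg ys u r') e e' with e zero | e' zero
  ... | refl | refl = cong (arg xs t) (Args-ext r r' (e ∘ suc) (e' ∘ suc))

  bodyAt-occurs : ∀ {as z} (r : Args as) i → z occurs bodyAt r i → z occursᴬ r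
  bodyAt-occurs (arg xs t r) zero    p = body p
  bodyAt-occurs (arg xs t r) (suc i) p = rest (bodyAt-occurs r i p)

  binders-chopᴬ : ∀ {as} n (r : Args as) i → binders (chopᴬ n r) i ≡ binders r i
  binders-chopᴬ n (arg {b = false} xs t r) zero    = refl
  binders-chopᴬ n (arg {b = true}  xs t r) zero    = refl
  binders-chopᴬ n (arg {b = false} xs t r) (suc i) = binders-chopᴬ n r i
  binders-chopᴬ n (arg {b = true}  xs t r) (suc i) = binders-chopᴬ n r i

  bodyAt-chopᴬ : ∀ {as} n (r : Args as) i →
                 bodyAt (chopᴬ n r) i ≡ chop (budget (proj₂ (lookup as i)) n) (bodyAt r i)
  bodyAt-chopᴬ n (arg {b = false} xs t r) zero    = refl
  bodyAt-chopᴬ n (arg {b = true}  xs t r) zero    = refl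
  bodyAt-chopᴬ n (arg {b = false} xs t r) (suc i) = bodyAt-chopᴬ n r i
  bodyAt-chopᴬ n (arg {b = true}  xs t r) (suc i) = bodyAt-chopᴬ n r i

  -- The number of variables bound in a slot is unknown, so its binder vector repeats a single
  -- variable.
  build : ∀ as → (Fin (length as) → V × Term) → Args as
  build []             h = []
  build ((n , b) ∷ as) h = arg (replicate n (proj₁ (h zero))) (proj₂ (h zero)) (build as (h ∘ suc))

  binders-build : ∀ as h i → binders (build as h) i ≡ replicate _ (proj₁ (h i))
  binders-build (_ ∷ as) h zero    = refl
  binders-build (_ ∷ as) h (suc i) = binders-build as (h ∘ suc) i

  bodyAt-build : ∀ as h i → bodyAt (build as h) i ≡ proj₂ (h i)
  bodyAt-build (_ ∷ as) h zero    = refl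
  bodyAt-build (_ ∷ as) h (suc i) = bodyAt-build as (h ∘ suc) i

  build-star-free : ∀ as h → (∀ i → StarFree V _≟_ Con ar (proj₂ (h i))) →
                    StarFreeA V _≟_ Con ar (build as h)
  build-star-free []       h p = []
  build-star-free (_ ∷ as) h p = arg (p zero) (build-star-free as (h ∘ suc) (p ∘ suc))

-- Countably many variables: agreement and visibility in canonical forms

module CountableVariables {V : Set} (_≟_ : DecidableEquality V) (Con : Set) (ar : Con → Arity)
  (em : ExcludedMiddle 0ℓ) (V-infinite : Infinite V)
  (f : ℕ → V) (f-surjective : ∀ v → ∃[ n ] f n ≡ v)
  (ℓ : Con) (ℓ-binding : Any (λ p → 1 ≤ proj₁ p) (ar ℓ))
  (N : Con) (N-binary : 2 ≤ length (ar N))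
  (G : Con) (G-coinductive : Any (λ p → proj₂ p ≡ true) (ar G)) where
  open Syntax _≟_ Con ar
  open Completeness _≟_ Con ar (fresh-variable em V-infinite)
  open Renaming _≟_ _≟'_ Con ar
  open Completion _≟_ Con ar em V-infinite
  open ArgumentAccess _≟_ Con ar
  open Soundness _≟_ _≟'_ Con ar inj₂ using (soundᴬ)
  module TargetAccess = ArgumentAccess _≟'_ Con ar

  canonical : (V → V ⊎ ℕ) → ℕ → Term → Target.Term
  canonical = canon inj₂

  canonicalᴬ : ∀ {as} → (V → V ⊎ ℕ) → ℕ → Args as → Target.Args as
  canonicalᴬ = canonᴬ inj₂

  under : ∀ {m} → Vec V m → (V → V ⊎ ℕ) → ℕ → V → V ⊎ ℕ
  under {m} xs ρ l = bind _≟_ ρ xs (names inj₂ m l)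

  binders-canonicalᴬ : ∀ {as} ρ l (r : Args as) i →
                       TargetAccess.binders (canonicalᴬ ρ l r) i ≡ names inj₂ _ l
  binders-canonicalᴬ ρ l (arg xs t r) zero    = refl
  binders-canonicalᴬ ρ l (arg xs t r) (suc i) = binders-canonicalᴬ ρ l r i

  bodyAt-canonicalᴬ : ∀ {as} ρ l (r : Args as) i →
    TargetAccess.bodyAt (canonicalᴬ ρ l r) i ≡
    canonical (under (binders r i) ρ l) (shift (proj₁ (lookup as i)) l) (bodyAt r i)
  bodyAt-canonicalᴬ ρ l (arg xs t r) zero    = refl
  bodyAt-canonicalᴬ ρ l (arg xs t r) (suc i) = bodyAt-canonicalᴬ ρ l r i

  bodyAt-canonical-build : ∀ as n ρ l h i →
    TargetAccess.bodyAt (canonicalᴬ ρ l (chopᴬ n (build as h))) i ≡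
    canonical (under (replicate (proj₁ (lookup as i)) (proj₁ (h i))) ρ l) (shift (proj₁ (lookup as i)) l)
      (chop (budget (proj₂ (lookup as i)) n) (proj₂ (h i)))
  bodyAt-canonical-build as n ρ l h i = begin
    TargetAccess.bodyAt (canonicalᴬ ρ l (chopᴬ n (build as h))) i
      ≡⟨ bodyAt-canonicalᴬ ρ l (chopᴬ n (build as h)) i ⟩
    canonical (under (binders (chopᴬ n (build as h)) i) ρ l) m (bodyAt (chopᴬ n (build as h)) i)
      ≡⟨ cong₂ (λ xs t → canonical (under xs ρ l) m t)
               (trans (binders-chopᴬ n (build as h) i) (binders-build as h i))
               (trans (bodyAt-chopᴬ n (build as h) i)
                      (cong (chop (budget (proj₂ (lookup as i)) n)) (bodyAt-build as h i))) ⟩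
    canonical (under (replicate (proj₁ (lookup as i)) (proj₁ (h i))) ρ l) m
      (chop (budget (proj₂ (lookup as i)) n) (proj₂ (h i))) ∎
    where
    open ≡-Reasoning
    m : ℕ
    m = shift (proj₁ (lookup as i)) l

  -- α-equivalence of truncations, phrased through canonical forms in all environments and at all
  -- levels, so that it passes under binders without a choice of fresh variables.
  Agree : ℕ → Term → Term → Set
  Agree n t u = ∀ ρ l → canonical ρ l (chop n t) ≡ canonical ρ l (chop n u)

  Agree-pred : ∀ {n t u} → Agree (suc n) t u → Agree n t u
  Agree-pred {n} {t} {u} e ρ l = trans (sym (lower t)) (trans (cong (Target.chop n) (e ρ l)) (lower u))
    where
    lower : ∀ t → Target.chop n (canonical ρ l (chop (suc n) t)) ≡ canonical ρ l (chop n t)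
    lower t = trans (canon-chop inj₂ n ρ l (chop (suc n) t)) (cong (canonical ρ l) (chop-chop t (n≤1+n n)))

  Agree-budget : ∀ b {n t u} → Agree (suc n) t u → Agree (budget b n) t u
  Agree-budget false e = e
  Agree-budget true  e = Agree-pred e

  SlotAgree : ℕ → V × Term → V × Term → Set
  SlotAgree n (x , t) (y , u) = ∀ m ρ l →
    canonical (under (replicate m x) ρ l) (shift m l) (chop n t) ≡
    canonical (under (replicate m y) ρ l) (shift m l) (chop n u)

  build-agree : ∀ {c n h h'} → (∀ i → SlotAgree (budget (proj₂ (lookup (ar c) i)) n) (h i) (h' i)) →
                Agree (suc n) (node c (build (ar c) h)) (node c (build (ar c) h'))
  build-agree {c} {n} {h} {h'} e ρ l = cong (node c) (TargetAccess.Args-ext _ _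
    (λ i → trans (binders-canonicalᴬ ρ l (chopᴬ n (build (ar c) h)) i)
                 (sym (binders-canonicalᴬ ρ l (chopᴬ n (build (ar c) h')) i)))
    (λ i → trans (bodyAt-canonical-build (ar c) n ρ l h i)
             (trans (e i (proj₁ (lookup (ar c) i)) ρ l) (sym (bodyAt-canonical-build (ar c) n ρ l h' i)))))

  -- Free occurrence in all truncations of precision at least `K`: bound variables become `inj₂`, so
  -- `inj₁ y` can only come from a free `y`.
  Visible : V → ℕ → Term → Set
  Visible y K t = ∀ {n} → K ≤ n → ∀ ρ l → ρ y ≡ inj₁ y → inj₁ y Target.occurs canonical ρ l (chop n t)

  var-visible : ∀ y → Visible y 1 (var y)
  var-visible y (s≤s _) ρ l e = subst (λ w → inj₁ y Target.occurs var w) (sym e) var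

  slot-visible : ∀ as {y K x t} h i → h i ≡ (x , t) → y ≢ x → Visible y K t →
                 ∀ {n} → K ≤ n → ∀ ρ l → ρ y ≡ inj₁ y →
                 inj₁ y Target.occurs TargetAccess.bodyAt (canonicalᴬ ρ l (chopᴬ n (build as h))) i
  slot-visible as {y} h i refl y≢x v {n} K≤n ρ l e =
    subst (inj₁ y Target.occurs_) (sym (bodyAt-canonical-build as n ρ l h i))
      (v (≤-trans K≤n (n≤budget (proj₂ (lookup as i)))) _ _
         (trans (bind-replicate-miss _≟_ (names inj₂ (proj₁ (lookup as i)) l) y≢x) e))

  build-visible : ∀ {y K x t c h} i → h i ≡ (x , t) → y ≢ x → Visible y K t →
                  Visible y (suc K) (node c (build (ar c) h))
  build-visible {c = c} {h} i e y≢x v (s≤s K≤n) ρ l e' =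
    node (TargetAccess.bodyAt-occurs (canonicalᴬ ρ l (chopᴬ _ (build (ar c) h))) i
      (slot-visible (ar c) h i e y≢x v K≤n ρ l e'))

  -- The Cauchy sequence without a limit

  w w' : V
  w  = proj₁ V-infinite 0
  w' = proj₁ V-infinite 1

  -- The slot holding the leaf `x` may bind variables; binding `other x` there keeps the leaf free.
  other : V → V
  other x with x ≟ w
  ... | yes _ = w'
  ... | no _  = w

  x≢other : ∀ x → x ≢ other x
  x≢other x with x ≟ w
  ... | yes refl = λ e → <⇒≢ (s≤s z≤n) (proj₂ V-infinite 0 1 e)
  ... | no x≢w   = x≢w

  N₀ N₁ : Fin (length (ar N))
  N₀ = Fin.fromℕ< (≤-trans (n≤1+n 1) N-binary)
  N₁ = Fin.fromℕ< N-binary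

  N₀≢N₁ : N₀ ≢ N₁
  N₀≢N₁ e with trans (sym (toℕ-fromℕ< (≤-trans (n≤1+n 1) N-binary)))
                     (trans (cong Fin.toℕ e) (toℕ-fromℕ< N-binary))
  ... | ()

  Gᵢ : Fin (length (ar G))
  Gᵢ = index G-coinductive

  ℓᵢ : Fin (length (ar ℓ))
  ℓᵢ = index ℓ-binding

  default : ∀ {n} → Fin n → V × Term
  default _ = w , var w

  N-slots : V → Term → Fin (length (ar N)) → V × Term
  N-slots x t = put N₁ (w , t) (put N₀ (other x , var x) default)

  N[_,_] : V → Term → Term
  N[ x , t ] = node N (build (ar N) (N-slots x t))

  G[_] : Term → Term
  G[ t ] = node G (build (ar G) (put Gᵢ (w , t) default))

  ℓ[_∙_] : V → Term → Term
  ℓ[ z ∙ t ] = node ℓ (build (ar ℓ) (put ℓᵢ (z , t) default))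

  put-agree : ∀ {c n h} i {p p'} → SlotAgree (budget (proj₂ (lookup (ar c) i)) n) p p' →
              Agree (suc n) (node c (build (ar c) (put i p h))) (node c (build (ar c) (put i p' h)))
  put-agree {c} {n} i e =
    build-agree (put-rel (λ j → SlotAgree (budget (proj₂ (lookup (ar c) j)) n)) i e (λ _ _ _ _ → refl))

  N-agree : ∀ {n x t u} → Agree (suc n) t u → Agree (suc n) N[ x , t ] N[ x , u ]
  N-agree e = put-agree N₁ (λ _ _ _ → Agree-budget (proj₂ (lookup (ar N) N₁)) e _ _)

  G-agree : ∀ {n t u} → Agree n t u → Agree (suc n) G[ t ] G[ u ]
  G-agree {n} {t} {u} e = put-agree Gᵢ λ m ρ l →
    -- The flag of this slot is known to be `true` only propositionally. Being coinductive, the slot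
    -- has budget `n`, which is where one level of precision is gained.
    subst (λ b → canonical (under (replicate m w) ρ l) (shift m l) (chop (budget b n) t) ≡
                 canonical (under (replicate m w) ρ l) (shift m l) (chop (budget b n) u))
          (sym (lookup-index G-coinductive)) (e _ _)

  chop-occurs  : ∀ {z} n t → z occurs chop n t → z occurs t
  chopᴬ-occursᴬ : ∀ {z as} n (r : Args as) → z occursᴬ chopᴬ n r → z occursᴬ r
  chop-occurs zero    t           ()
  chop-occurs (suc n) (var x)     p        = p
  chop-occurs (suc n) (node c as) (node p) = node (chopᴬ-occursᴬ n as p)
  chopᴬ-occursᴬ n (arg {b = false} xs t r) (binder p) = binder p
  chopᴬ-occursᴬ n (arg {b = true}  xs t r) (binder p) = binder p
  chopᴬ-occursᴬ n (arg {b = false} xs t r) (body p)   = body (chop-occurs (suc n) t p)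
  chopᴬ-occursᴬ n (arg {b = true}  xs t r) (body p)   = body (chop-occurs n t p)
  chopᴬ-occursᴬ n (arg {b = false} xs t r) (rest p)   = rest (chopᴬ-occursᴬ n r p)
  chopᴬ-occursᴬ n (arg {b = true}  xs t r) (rest p)   = rest (chopᴬ-occursᴬ n r p)

  -- A binder absent from its body binds nothing, so both bodies can be read in the outer
  -- environment, whichever variables are bound.
  ℓ-agree : ∀ {n y z t u} → ¬ y occurs t → ¬ z occurs u → Agree (suc n) t u →
            Agree (suc n) ℓ[ y ∙ t ] ℓ[ z ∙ u ]
  ℓ-agree {n} {y} {z} {t} {u} y∉t z∉u e = put-agree ℓᵢ λ m ρ l →
    trans (vacuous y∉t m ρ l) (trans (Agree-budget b e ρ (shift m l)) (sym (vacuous z∉u m ρ l)))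
    where
    b : Bool
    b = proj₂ (lookup (ar ℓ) ℓᵢ)
    vacuous : ∀ {z t} → ¬ z occurs t → ∀ m ρ l →
              canonical (under (replicate m z) ρ l) (shift m l) (chop (budget b n) t) ≡
              canonical ρ (shift m l) (chop (budget b n) t)
    vacuous {z} {t} z∉t m ρ l = canon-cong inj₂ (shift m l) _ λ v p →
      bind-replicate-miss _≟_ (names inj₂ m l) λ { refl → z∉t (chop-occurs (budget b n) t p) }

  spine : ℕ → (ℕ → V) → Term
  spine zero    x = var w
  spine (suc d) x = N[ x 0 , G[ spine d (x ∘ suc) ] ]

  spine-agree : ∀ n {d d'} x → n ≤ d → n ≤ d' → Agree n (spine d x) (spine d' x)
  spine-agree zero    x p       q       ρ l = refl
  spine-agree (suc n) x (s≤s p) (s≤s q) = N-agree (G-agree (spine-agree n (x ∘ suc) p q))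

  -- A sufficient budget: one for the last `N`, one for the leaf, and two for each `N` and `G`
  -- passed before. Inductive slots would cost less.
  depth : ℕ → ℕ
  depth zero    = 2
  depth (suc m) = suc (suc (depth m))

  -- Apart from those of the leaves x m themselves, all binders of the spine are w.
  spine-visible : ∀ m {d} x → m < d → m ≡ 0 ⊎ x m ≢ w → Visible (x m) (depth m) (spine d x)
  spine-visible zero x (s≤s _) _ =
    build-visible N₀
      (trans (put-miss (put N₀ (other (x 0) , var (x 0)) default) N₀≢N₁) (put-hit N₀ default))
      (x≢other (x 0)) (var-visible (x 0))
  spine-visible (suc m) {suc d} x (s≤s m<d) (inj₂ xm≢w) =
    build-visible {x = w} N₁ (put-hit N₁ (put N₀ (other (x 0) , var (x 0)) default)) xm≢w
      (build-visible {x = w} Gᵢ (put-hit Gᵢ default) xm≢w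
        (spine-visible m (x ∘ suc) m<d (inj₂ xm≢w)))

  build-occurs : ∀ {as x y t h} i → h i ≡ (x , t) → y occurs t → y occursᴬ build as h
  build-occurs {as} {y = y} {h = h} i refl p =
    bodyAt-occurs (build as h) i (subst (y occurs_) (sym (bodyAt-build as h i)) p)

  spine-occurs : ∀ m {d} x → m < d → x m occurs spine d x
  spine-occurs zero x (s≤s _) = node (build-occurs N₀
    (trans (put-miss (put N₀ (other (x 0) , var (x 0)) default) N₀≢N₁) (put-hit N₀ default)) var)
  spine-occurs (suc m) x (s≤s m<d) =
    node (build-occurs N₁ (put-hit N₁ (put N₀ (other (x 0) , var (x 0)) default))
      (node (build-occurs Gᵢ (put-hit Gᵢ default) (spine-occurs m (x ∘ suc) m<d))))

  put-star-free : ∀ {n} i {x t} {h : Fin n → V × Term} → StarFree V _≟_ Con ar t →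
                  (∀ j → StarFree V _≟_ Con ar (proj₂ (h j))) →
                  ∀ j → StarFree V _≟_ Con ar (proj₂ (put i (x , t) h j))
  put-star-free i {x} {t} {h} p ps =
    put-rel (λ _ a _ → StarFree V _≟_ Con ar (proj₂ a)) i {a' = x , t} {h' = h} p ps

  spine-star-free : ∀ d x → StarFree V _≟_ Con ar (spine d x)
  spine-star-free zero    x = var
  spine-star-free (suc d) x = node (build-star-free _ _ (put-star-free N₁
    (node (build-star-free _ _ (put-star-free Gᵢ (spine-star-free d (x ∘ suc)) (λ _ → var))))
    (put-star-free N₀ var (λ _ → var))))

  -- w is put first, where no inner binder w captures it yet.
  x : ℕ → V
  x zero    = w
  x (suc n) = f n

  x-surjective : ∀ y → ∃[ m ] x m ≡ y × (m ≡ 0 ⊎ x m ≢ w)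
  x-surjective y with y ≟ w
  ... | yes refl = 0 , refl , inj₁ refl
  ... | no y≢w with f-surjective y
  ...   | n , refl = suc n , refl , inj₂ y≢w

  z : ℕ → V
  z k = proj₁ (fresh-variable em V-infinite (vars (spine k x)))

  z∉spine : ∀ k → ¬ z k occurs spine k x
  z∉spine k = proj₂ (fresh-variable em V-infinite (vars (spine k x))) ∘ occurs⇒∈vars

  s : ℕ → Term
  s k = ℓ[ z k ∙ spine k x ]

  s-finite : FiniteSeq V _≟_ Con ar s
  s-finite k = node (build-star-free _ _ (put-star-free ℓᵢ (spine-star-free k x) (λ _ → var)))

  s-cauchy : Cauchy V _≟_ Con ar s
  s-cauchy n = n , λ i j n≤i n≤j → complete (agree n n≤i n≤j inj₁ 0)
    where
    agree : ∀ n {i j} → n ≤ i → n ≤ j → Agree n (s i) (s j)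
    agree zero    _ _ ρ l = refl
    agree (suc n) {i} {j} p q = ℓ-agree (z∉spine i) (z∉spine j) (spine-agree (suc n) x p q)

  -- No mixed term represents the limit

  update-hides : ∀ {ρ : V → V ⊎ ℕ} {y} u l → (∀ v → ρ v ≢ inj₁ y) → ∀ v → update _≟_ ρ u (inj₂ l) v ≢ inj₁ y
  update-hides u l e v with v ≟ u
  ... | yes _ = λ ()
  ... | no _  = e v

  under-hides : ∀ {m ρ y} (xs : Vec V m) l → (∀ v → ρ v ≢ inj₁ y) → ∀ v → under xs ρ l v ≢ inj₁ y
  under-hides []       l e = e
  under-hides (u ∷ us) l e = under-hides us (suc l) (update-hides u l e)

  -- Only `y` itself could be sent to `inj₁ y`, and the binder overwrites its value by a depth;
  -- later binders bring in only depths as well.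
  under-binder-hides : ∀ {m ρ y} {xs : Vec V m} l → y ∈ᵛ xs → (∀ v → ρ v ≡ inj₁ y → v ≡ y) →
                       ∀ v → under xs ρ l v ≢ inj₁ y
  under-binder-hides {ρ = ρ} {y} l (here {xs = xs}) e = under-hides xs (suc l) hidden
    where
    hidden : ∀ v → update _≟_ ρ y (inj₂ l) v ≢ inj₁ y
    hidden v with v ≟ y
    ... | yes _  = λ ()
    ... | no v≢y = v≢y ∘ e v
  under-binder-hides {ρ = ρ} {y} l (there {y = u} p) e = under-binder-hides (suc l) p only
    where
    only : ∀ v → update _≟_ ρ u (inj₂ l) v ≡ inj₁ y → v ≡ y
    only v with v ≟ u
    ... | yes _ = λ ()
    ... | no _  = e v

  hidden-not-occurs  : ∀ {y ρ l} t → (∀ v → ρ v ≢ inj₁ y) → ¬ inj₁ y Target.occurs canonical ρ l t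
  hidden-not-occursᴬ : ∀ {y ρ l as} (r : Args as) → (∀ v → ρ v ≢ inj₁ y) →
                       ¬ inj₁ y Target.occursᴬ canonicalᴬ ρ l r
  hidden-not-occurs {y} {ρ} (var v) e p = go refl p
    where
    go : ∀ {u} → u ≡ ρ v → ¬ inj₁ y Target.occurs var u
    go q var = e v (sym q)
  hidden-not-occurs (node c as) e (node p) = hidden-not-occursᴬ as e p
  hidden-not-occursᴬ {l = l} (arg {n} xs t r) e (binder p) = not-name n l p
    where
    not-name : ∀ {y} m l → ¬ inj₁ y Target.∈ᵛ names inj₂ m l
    not-name (suc m) l (there p) = not-name m (suc l) p
  hidden-not-occursᴬ {l = l} (arg xs t r) e (body p) = hidden-not-occurs t (under-hides xs l e) p
  hidden-not-occursᴬ (arg xs t r) e (rest p) = hidden-not-occursᴬ r e p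

  ≈-node : ∀ {t c bs} → t ≈ node c bs → ∃[ as ] t ≡ node c as × as ≈ᴬ bs
  ≈-node (node p) = _ , refl , p

  member : ∀ {m} → 1 ≤ m → (xs : Vec V m) → ∃[ y ] y ∈ᵛ xs
  member (s≤s _) (y ∷ _) = y , here

  node-args-injective : ∀ {c} {r r' : Args (ar c)} → FT.node c r ≡ node c r' → r ≡ r'
  node-args-injective refl = refl

  -- Some `y` is bound at `ℓ` in `t`, hence hidden in the canonical form of the body. In `s k` the
  -- binder is `z k`, which differs from `y`, so `y` is visible there; soundness identifies the two
  -- canonical forms.
  no-limit : ∀ t s' → t ↝ s' → s' ∼′ s → ⊥
  no-limit t s' t↝s' s'∼s =
    hidden-not-occurs (bodyAt r ℓᵢ) (under-binder-hides 0 y∈binders (λ _ → inj₁-injective)) y-occurs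
    where
    top : ∀ n K → ∃[ k ] ∃[ as ] K ≤ k × approx t (suc n) ≡ node ℓ as ×
            as ≈ᴬ chopᴬ n (build (ar ℓ) (put ℓᵢ (z k , spine k x) default))
    top n K with approx-≈ t t↝s' s'∼s (suc n)
    ... | M , p with ≈-node (p (K ⊔ M) (m≤n⊔m K M))
    ...   | as , e , q = K ⊔ M , as , m≤m⊔n K M , e , q

    r₀ : Args (ar ℓ)
    r₀ = proj₁ (proj₂ (top 0 0))

    y : V
    y = proj₁ (member (lookup-index ℓ-binding) (binders r₀ ℓᵢ))

    m : ℕ
    m = proj₁ (x-surjective y)

    -- The index is at least `suc m`, so that the spine of `s k` reaches `x m`; the `ℓ` node takes
    -- one more unit of precision than `depth m`.
    k : ℕ
    k = proj₁ (top (depth m) (suc m))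

    m<k : m < k
    m<k = proj₁ (proj₂ (proj₂ (top (depth m) (suc m))))

    r : Args (ar ℓ)
    r = proj₁ (proj₂ (top (depth m) (suc m)))

    approx-r : approx t (suc (depth m)) ≡ node ℓ r
    approx-r = proj₁ (proj₂ (proj₂ (proj₂ (top (depth m) (suc m)))))

    r≈ : r ≈ᴬ chopᴬ (depth m) (build (ar ℓ) (put ℓᵢ (z k , spine k x) default))
    r≈ = proj₂ (proj₂ (proj₂ (proj₂ (top (depth m) (suc m)))))

    -- Coherence is an equality of raw terms, so the deep truncation binds literally the `y` read
    -- off at precision 1.
    r-chop : chopᴬ 0 r ≡ r₀
    r-chop = node-args-injective (begin
      chop 1 (node ℓ r)                 ≡⟨ cong (chop 1) approx-r ⟨
      chop 1 (approx t (suc (depth m))) ≡⟨ chop-approx t (s≤s z≤n) ⟩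
      approx t 1                        ≡⟨ proj₁ (proj₂ (proj₂ (proj₂ (top 0 0)))) ⟩
      node ℓ r₀                         ∎)
      where open ≡-Reasoning

    y∈binders : y ∈ᵛ binders r ℓᵢ
    y∈binders = subst (y ∈ᵛ_)
      (trans (cong (λ r → binders r ℓᵢ) (sym r-chop)) (binders-chopᴬ 0 r ℓᵢ))
      (proj₂ (member (lookup-index ℓ-binding) (binders r₀ ℓᵢ)))

    y-visible : ∀ {d} → m < d → Visible y (depth m) (spine d x)
    y-visible m<d = subst (λ v → Visible v (depth m) (spine _ x)) (proj₁ (proj₂ (x-surjective y)))
      (spine-visible m x m<d (proj₂ (proj₂ (x-surjective y))))

    y≢z : y ≢ z k
    y≢z y≡z = z∉spine k (subst (_occurs spine k x) (trans (proj₁ (proj₂ (x-surjective y))) y≡z)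
                          (spine-occurs m x m<k))

    y-occurs : inj₁ y Target.occurs
               canonical (under (binders r ℓᵢ) inj₁ 0) (shift (proj₁ (lookup (ar ℓ) ℓᵢ)) 0) (bodyAt r ℓᵢ)
    y-occurs = subst (inj₁ y Target.occurs_)
      (trans (cong (λ r → TargetAccess.bodyAt r ℓᵢ)
                 (sym (soundᴬ r≈ inj₁ 0)))
             (bodyAt-canonicalᴬ inj₁ 0 r ℓᵢ))
      (slot-visible (ar ℓ) (put ℓᵢ (z k , spine k x) default) ℓᵢ
        (put-hit ℓᵢ default) y≢z (y-visible m<k) ≤-refl inj₁ 0 refl)

theorem1p14 : (V : Set) (_≟_ : DecidableEquality V)
    (Con : Set) (ar : Con → List (ℕ × Bool)) →
    ExcludedMiddle 0ℓ →
    AtMostCountable Con →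
    Infinite V →
    NonTrivial Con ar →
    (CanonicalInjectionBijective V _≟_ Con ar ⇔ Uncountable V)
theorem1p14 V _≟_ Con ar em _ V-infinite ((ℓ , ℓ-binding) , (N , N-binary) , (G , G-coinductive)) =
  mk⇔ uncountable (UncountableVariables.bijective _≟_ Con ar em V-infinite)
  where
  uncountable : CanonicalInjectionBijective V _≟_ Con ar → Uncountable V
  uncountable _ (inj₁ V-empty) = V-empty (proj₁ V-infinite 0)
  uncountable (_ , _ , _ , surjective) (inj₂ (f , f-surjective)) =
    let (t , s' , t↝s' , s'∼s) = surjective s s-finite s-cauchy in no-limit t s' t↝s' s'∼s
    where
    open CountableVariables _≟_ Con ar em V-infinite f f-surjective
      ℓ ℓ-binding N N-binary G G-coinductive
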